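{- Let $p$ be an odd prime, let $v$ be an integer with $1<v<p-1$, let $g\in\{2,\dots,p-1\}$ be a primitive root modulo $p$ with $\gcd(g,v)=1$, let $t\ge1$ and $b\in\{0,\dots,v-1\}$. Let $$\rho(b,t)=\#\{i\in[1,p-1]:\ g^i\,\%\,p\not\equiv b,\ g^{i+t+1}\,\%\,p\not\equiv b,\ g^{i+j}\,\%\,p\equiv b\ (1\le j\le t)\},$$ all congruences modulo $v$. Write $p=q\,g^{t+1}+r$ with $0\le r<g^{t+1}$. Then $$\left\lfloor\frac{g}{v}\right\rfloor^{t-1}\left\lfloor\frac{(v-1)g}{v}\right\rfloor^2\left\lfloor\frac{q}{v}\right\rfloor\ \le\ \rho(b,t)\ \le\ \left\lceil\frac{g}{v}\right\rceil^{t-1}\left\lceil\frac{(v-1)g}{v}\right\rceil^2\left\lceil\frac{q+1}{v}\right\rceil.$$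
   Context: $x\,\%\,p$ denotes the least nonnegative remainder of the integer $x$ modulo $p$. -}

module Defs where

open import Data.List.Base using (List; applyUpTo; filter; length)
open import Data.List.Relation.Unary.All using (All; all?)
open import Data.Nat.Base using (ℕ; suc; _+_; _∸_; _^_; _%_; NonZero)
open import Data.Nat.GCD using (gcd)
open import Data.Nat.Properties using (_≟_)
open import Data.Product.Base using (_×_; ∃-syntax)
open import Relation.Binary.PropositionalEquality.Core using (_≡_)
open import Relation.Nullary.Decidable.Core using (Dec; _×-dec_; ¬?)
open import Relation.Nullary.Negation.Core using (¬_)

infix 4 _≡_[mod_] _≡_[mod_]?

_≡_[mod_] : (a b n : ℕ) .{{_ : NonZero n}} → Set
a ≡ b [mod n ] = a % n ≡ b % n

_≡_[mod_]? : (a b n : ℕ) .{{_ : NonZero n}} → Dec (a ≡ b [mod n ])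
a ≡ b [mod n ]? = a % n ≟ b % n

PrimitiveRoot : (n g : ℕ) .{{_ : NonZero n}} → Set
PrimitiveRoot n g =
  gcd g n ≡ 1 × (∀ a → gcd a n ≡ 1 → ∃[ k ] (g ^ k ≡ a [mod n ]))

[1‥_] : ℕ → List ℕ
[1‥ n ] = applyUpTo suc n

module _ (p g v : ℕ) .{{_ : NonZero p}} .{{_ : NonZero v}} (b t : ℕ) where

  -- The residues g ^ i % p are reduced modulo v as integers in [0, p), so a
  -- maximal run of exactly t terms congruent to b starts at index i + 1.
  RunAfter : ℕ → Set
  RunAfter i =
      ¬ (g ^ i % p ≡ b [mod v ])
    × ¬ (g ^ (i + t + 1) % p ≡ b [mod v ])
    × All (λ j → g ^ (i + j) % p ≡ b [mod v ]) [1‥ t ]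

  runAfter? : ∀ i → Dec (RunAfter i)
  runAfter? i =
          ¬? (g ^ i % p ≡ b [mod v ]?)
    ×-dec ¬? (g ^ (i + t + 1) % p ≡ b [mod v ]?)
    ×-dec all? (λ j → g ^ (i + j) % p ≡ b [mod v ]?) [1‥ t ]

  ρ : ℕ
  ρ = length (filter runAfter? [1‥ p ∸ 1 ])

{-# OPTIONS --safe #-}
module Submission where

-- The powers g ^ i % p run once through the x in [1, p), so ρ counts starting
-- points x. Put N = g ^ (t + 1) and c = ⌊N x / p⌋ < N. The orbit of x satisfies
-- x_{j+1} = g x_j - p d_{j+1}, where d_1, …, d_{t+1} are the base-g digits of c,
-- leading digit first. A digit carries residue b to residue b modulo v exactly
-- when it lies in one residue class K modulo v; hence x starts a maximal run iff
-- d_1, d_{t+1} ∉ K, d_2, …, d_t ∈ K and g x ≡ p d_1 + b (mod v). Given c, the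
-- last condition picks a residue class modulo v from an interval of q or q + 1
-- integers x, and the other conditions are independent choices of digits.

open import Defs
open import Data.Fin.Base using (Fin; toℕ; fromℕ<)
open import Data.Fin.Properties using (pigeonhole; toℕ≤pred[n]; fromℕ<-injective)
import Data.Integer.DivMod as ℤ
import Data.Integer.Properties as ℤ
open import Data.List.Base using (List; []; _∷_; _++_; applyUpTo; filter; length; map)
open import Data.List.Membership.Propositional using (_∈_)
open import Data.List.Membership.Propositional.Properties using (∈-∃++; ∈-applyUpTo⁺; ∈-applyUpTo⁻)
open import Data.List.Properties using (length-applyUpTo; map-applyUpTo)
open import Data.List.Relation.Binary.Permutation.Propositional using (_↭_; ↭-refl; ↭-sym; ↭-trans; ↭-prep)
open import Data.List.Relation.Binary.Permutation.Propositional.Properties using (shift; ↭-length; ∈-resp-↭; map⁺)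
import Data.List.Relation.Unary.All as All
import Data.List.Relation.Unary.All.Properties as All
open import Data.List.Relation.Unary.AllPairs using (_∷_)
open import Data.List.Relation.Unary.Any using (here; there)
open import Data.List.Relation.Unary.Unique.Propositional using (Unique)
open import Data.List.Relation.Unary.Unique.Propositional.Properties using (applyUpTo⁺₁)
open import Data.Nat.Base as ℕ using (ℕ; zero; suc; NonZero; _∸_)
open import Data.Nat.Coprimality using (Coprime; coprime-Bézout; coprime⇒gcd≡1; gcd≡1⇒coprime; prime⇒coprime)
import Data.Nat.DivMod as ℕ
open import Data.Nat.Divisibility using (_∣_; divides-refl)
open import Data.Nat.GCD using (gcd; gcd-comm; module Bézout)
open import Data.Nat.ListAction using (sum)
open import Data.Nat.ListAction.Properties using (sum-↭)
open import Data.Nat.Primality using (Prime; prime⇒nonTrivial)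
import Data.Nat.Properties as ℕ
open import Data.Nat.Tactic.RingSolver using (solve-∀)
open import Data.Product.Base using (_×_; _,_; ∃-syntax; proj₁; proj₂)
open import Data.Sum.Base using (inj₁; inj₂)
open import Function.Base using (_∘_; case_of_)
open import Function.Bundles using (_⇔_; mk⇔; module Equivalence)
open import Relation.Binary.PropositionalEquality using (_≡_; _≢_; refl; sym; trans; cong; cong₂; subst; subst₂; module ≡-Reasoning)
open import Relation.Nullary.Decidable.Core using (Dec; yes; no; _×-dec_; ¬?)
open import Relation.Nullary.Negation.Core using (¬_; contradiction)
open import Relation.Unary using (Decidable)

module _ where

  open import Data.Nat.Base
  open import Data.Nat.DivMod
  open import Data.Nat.Properties

  -- Arithmetic of congruences

  module _ {n : ℕ} .{{_ : NonZero n}} where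

    +-congᵐ : ∀ {a b c d} → a ≡ b [mod n ] → c ≡ d [mod n ] → a + c ≡ b + d [mod n ]
    +-congᵐ {a} {b} {c} {d} a≡b c≡d = begin
      (a + c) % n          ≡⟨ %-distribˡ-+ a c n ⟩
      (a % n + c % n) % n  ≡⟨ cong₂ (λ x y → (x + y) % n) a≡b c≡d ⟩
      (b % n + d % n) % n  ≡⟨ %-distribˡ-+ b d n ⟨
      (b + d) % n          ∎
      where open ≡-Reasoning

    *-congᵐ : ∀ {a b c d} → a ≡ b [mod n ] → c ≡ d [mod n ] → a * c ≡ b * d [mod n ]
    *-congᵐ {a} {b} {c} {d} a≡b c≡d = begin
      (a * c) % n              ≡⟨ %-distribˡ-* a c n ⟩
      ((a % n) * (c % n)) % n  ≡⟨ cong₂ (λ x y → (x * y) % n) a≡b c≡d ⟩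
      ((b % n) * (d % n)) % n  ≡⟨ %-distribˡ-* b d n ⟨
      (b * d) % n              ∎
      where open ≡-Reasoning

    *-congˡᵐ : ∀ m {a b} → a ≡ b [mod n ] → m * a ≡ m * b [mod n ]
    *-congˡᵐ m {a} {b} = *-congᵐ {m} {m} {a} {b} refl

    ^-congᵐ : ∀ {a b} → a ≡ b [mod n ] → ∀ k → a ^ k ≡ b ^ k [mod n ]
    ^-congᵐ         a≡b zero    = refl
    ^-congᵐ {a} {b} a≡b (suc k) = *-congᵐ {a} {b} {a ^ k} a≡b (^-congᵐ {a} {b} a≡b k)

    -- Subtraction of `c` is replaced by addition of `c * pred n`, which completes `c` to the
    -- multiple `c * n` of the modulus.
    +-cancelʳᵐ : ∀ c {a b} → a + c ≡ b + c [mod n ] → a ≡ b [mod n ]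
    +-cancelʳᵐ c {a} {b} a+c≡b+c = begin
      a % n                      ≡⟨ [m+kn]%n≡m%n a c n ⟨
      (a + c * n) % n            ≡⟨ cong (_% n) (split a) ⟩
      (a + c + c * pred n) % n   ≡⟨ +-congᵐ {a + c} {b + c} {c * pred n} a+c≡b+c refl ⟩
      (b + c + c * pred n) % n   ≡⟨ cong (_% n) (split b) ⟨
      (b + c * n) % n            ≡⟨ [m+kn]%n≡m%n b c n ⟩
      b % n                      ∎
      where
      open ≡-Reasoning
      split : ∀ a → a + c * n ≡ a + c + c * pred n
      split a = begin
        a + c * n               ≡⟨ cong (λ m → a + c * m) (suc-pred n) ⟨
        a + c * suc (pred n)    ≡⟨ cong (a +_) (*-suc c (pred n)) ⟩
        a + (c + c * pred n)    ≡⟨ +-assoc a c _ ⟨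
        a + c + c * pred n      ∎

    +-cancelˡᵐ : ∀ c {a b} → c + a ≡ c + b [mod n ] → a ≡ b [mod n ]
    +-cancelˡᵐ c {a} {b} eq = +-cancelʳᵐ c {a} {b}
      (subst₂ _≡_ (cong (_% n) (+-comm c a)) (cong (_% n) (+-comm c b)) eq)

    module _ {m : ℕ} (m⊥n : Coprime m n) where

      inverseᵐ : ∃[ h ] h * m ≡ 1 [mod n ]
      inverseᵐ with coprime-Bézout m⊥n
      ... | Bézout.+- x y eq = x , trans (cong (_% n) (sym eq)) ([m+kn]%n≡m%n 1 y n)
      -- Here `1 + x * m` is a multiple of `n`, so `x` is minus an inverse of `m`; the factor
      -- `pred n` acts as -1.
      ... | Bézout.-+ x y eq = x * pred n , +-cancelʳᵐ (x * m) {x * pred n * m} {1} (begin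
        (x * pred n * m + x * m) % n  ≡⟨ cong (_% n) (regroup x (pred n) m) ⟩
        ((x * m) * suc (pred n)) % n  ≡⟨ cong (λ k → ((x * m) * k) % n) (suc-pred n) ⟩
        ((x * m) * n) % n             ≡⟨ m*n%n≡0 (x * m) n ⟩
        0                             ≡⟨ m*n%n≡0 y n ⟨
        (y * n) % n                   ≡⟨ cong (_% n) eq ⟨
        (1 + x * m) % n               ∎)
        where
        open ≡-Reasoning
        regroup : ∀ x k m → x * k * m + x * m ≡ (x * m) * suc k
        regroup = solve-∀

      *-cancelˡᵐ : ∀ {a b} → m * a ≡ m * b [mod n ] → a ≡ b [mod n ]
      *-cancelˡᵐ {a} {b} ma≡mb with h , hm≡1 ← inverseᵐ = begin
        a % n              ≡⟨ undo a ⟨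
        (h * (m * a)) % n  ≡⟨ *-congˡᵐ h {m * a} {m * b} ma≡mb ⟩
        (h * (m * b)) % n  ≡⟨ undo b ⟩
        b % n              ∎
        where
        open ≡-Reasoning
        undo : ∀ a → h * (m * a) ≡ a [mod n ]
        undo a = begin
          (h * (m * a)) % n  ≡⟨ cong (_% n) (*-assoc h m a) ⟨
          (h * m * a) % n    ≡⟨ *-congᵐ {h * m} {1} {a} hm≡1 refl ⟩
          (1 * a) % n        ≡⟨ cong (_% n) (*-identityˡ a) ⟩
          a % n              ∎

      *-solveᵐ : ∀ c → ∃[ x ] x < n × m * x ≡ c [mod n ]
      *-solveᵐ c with h , hm≡1 ← inverseᵐ = (h * c) % n , m%n<n (h * c) n , (begin
        (m * ((h * c) % n)) % n  ≡⟨ *-congˡᵐ m {(h * c) % n} {h * c} (m%n%n≡m%n (h * c) n) ⟩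
        (m * (h * c)) % n        ≡⟨ cong (_% n) (regroup m h c) ⟩
        (h * m * c) % n          ≡⟨ *-congᵐ {h * m} {1} {c} hm≡1 refl ⟩
        (1 * c) % n              ≡⟨ cong (_% n) (*-identityˡ c) ⟩
        c % n                    ∎)
        where
        open ≡-Reasoning
        regroup : ∀ m h c → m * (h * c) ≡ h * m * c
        regroup = solve-∀

  -- Sums and indicators

  ∑ : ℕ → (ℕ → ℕ) → ℕ
  ∑ n f = sum (applyUpTo f n)

  infix 10 ∑
  syntax ∑ n (λ x → e) = ∑[ x < n ] e

  ∑-cong : ∀ n {f h} → (∀ {x} → x < n → f x ≡ h x) → ∑ n f ≡ ∑ n h
  ∑-cong zero    f≡h = refl
  ∑-cong (suc n) f≡h = cong₂ _+_ (f≡h z<s) (∑-cong n (f≡h ∘ s<s))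

  ∑-mono : ∀ n {f h} → (∀ {x} → x < n → f x ≤ h x) → ∑ n f ≤ ∑ n h
  ∑-mono zero    f≤h = z≤n
  ∑-mono (suc n) f≤h = +-mono-≤ (f≤h z<s) (∑-mono n (f≤h ∘ s<s))

  ∑-zero : ∀ n {f} → (∀ {x} → x < n → f x ≡ 0) → ∑ n f ≡ 0
  ∑-zero zero    f≡0 = refl
  ∑-zero (suc n) f≡0 = cong₂ _+_ (f≡0 z<s) (∑-zero n (f≡0 ∘ s<s))

  ∑-split : ∀ m n f → ∑ (m + n) f ≡ ∑ m f + ∑ n (λ x → f (m + x))
  ∑-split zero    n f = refl
  ∑-split (suc m) n f = trans (cong (f 0 +_) (∑-split m n (f ∘ suc))) (sym (+-assoc (f 0) _ _))

  ∑-monoˡ : ∀ {m n} f → m ≤ n → ∑ m f ≤ ∑ n f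
  ∑-monoˡ {m} {n} f m≤n = begin
    ∑ m f                                  ≤⟨ m≤m+n _ _ ⟩
    ∑ m f + ∑ (n ∸ m) (λ x → f (m + x))    ≡⟨ ∑-split m (n ∸ m) f ⟨
    ∑ (m + (n ∸ m)) f                      ≡⟨ cong (λ k → ∑ k f) (m+[n∸m]≡n m≤n) ⟩
    ∑ n f                                  ∎
    where open ≤-Reasoning

  ∑-*ˡ : ∀ n k f → ∑ n (λ x → k * f x) ≡ k * ∑ n f
  ∑-*ˡ zero    k f = sym (*-zeroʳ k)
  ∑-*ˡ (suc n) k f = trans (cong (k * f 0 +_) (∑-*ˡ n k (f ∘ suc))) (sym (*-distribˡ-+ k _ _))

  ∑-*ʳ : ∀ n k f → ∑ n (λ x → f x * k) ≡ ∑ n f * k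
  ∑-*ʳ n k f = trans (∑-cong n (λ {x} _ → *-comm (f x) k)) (trans (∑-*ˡ n k f) (*-comm k _))

  ∑-partition : ∀ N (e : ℕ → ℕ) f → e 0 ≡ 0 → (∀ c → e c ≤ e (suc c)) →
    ∑ (e N) f ≡ ∑[ c < N ] ∑[ x < e (suc c) ∸ e c ] f (e c + x)
  ∑-partition N e f e0≡0 e-mono =
    trans (go N e e-mono) (cong (λ k → ∑ k f + rest) e0≡0)
    where
    rest = ∑[ c < N ] ∑[ x < e (suc c) ∸ e c ] f (e c + x)
    -- The induction on `N` replaces `e` by its shift `e ∘ suc`, so the first cut point `e 0` has to
    -- be arbitrary.
    go : ∀ N (e : ℕ → ℕ) → (∀ c → e c ≤ e (suc c)) →
      ∑ (e N) f ≡ ∑ (e 0) f + ∑[ c < N ] ∑[ x < e (suc c) ∸ e c ] f (e c + x)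
    go zero    e e-mono = sym (+-identityʳ _)
    go (suc N) e e-mono = begin
      ∑ (e (suc N)) f                    ≡⟨ go N (e ∘ suc) (e-mono ∘ suc) ⟩
      ∑ (e 1) f + tail                   ≡⟨ cong (λ k → ∑ k f + tail) (m+[n∸m]≡n (e-mono 0)) ⟨
      ∑ (e 0 + (e 1 ∸ e 0)) f + tail     ≡⟨ cong (_+ tail) (∑-split (e 0) (e 1 ∸ e 0) f) ⟩
      ∑ (e 0) f + head + tail            ≡⟨ +-assoc (∑ (e 0) f) head tail ⟩
      ∑ (e 0) f + (head + tail)          ∎
      where
      open ≡-Reasoning
      head = ∑[ x < e 1 ∸ e 0 ] f (e 0 + x)
      tail = ∑[ c < N ] ∑[ x < e (suc (suc c)) ∸ e (suc c) ] f (e (suc c) + x)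

  -- Each `c` below `m * n` is a pair of a leading part below `m` and a last digit below `n`, chosen
  -- independently; hence the double sum factors.
  ∑-digits : ∀ m n .{{_ : NonZero n}} (f h : ℕ → ℕ) →
    ∑[ c < m * n ] (f (c / n) * h (c % n)) ≡ ∑ m f * ∑ n h
  ∑-digits m n f h = begin
    ∑[ c < m * n ] fh c
      ≡⟨ ∑-partition m (_* n) fh refl (λ c → m≤n+m (c * n) n) ⟩
    ∑[ c < m ] ∑[ d < suc c * n ∸ c * n ] fh (c * n + d)
      ≡⟨ ∑-cong m (λ {c} _ → trans (cong (λ k → ∑[ d < k ] fh (c * n + d)) (m+n∸n≡m n (c * n))) (∑-cong n (digit c))) ⟩
    ∑[ c < m ] ∑[ d < n ] (f c * h d)
      ≡⟨ ∑-cong m (λ {c} _ → ∑-*ˡ n (f c) h) ⟩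
    ∑[ c < m ] (f c * ∑ n h)
      ≡⟨ ∑-*ʳ m (∑ n h) f ⟩
    ∑ m f * ∑ n h
      ∎
    where
    open ≡-Reasoning
    fh : ℕ → ℕ
    fh c = f (c / n) * h (c % n)
    digit : ∀ c {d} → d < n → fh (c * n + d) ≡ f c * h d
    digit c {d} d<n = cong₂ (λ x y → f x * h y)
      (begin
        (c * n + d) / n       ≡⟨ +-distrib-/ (c * n) d (subst (_< n) (sym (cong₂ _+_ (m*n%n≡0 c n) (m<n⇒m%n≡m d<n))) d<n) ⟩
        c * n / n + d / n     ≡⟨ cong₂ _+_ (m*n/n≡m c n) (m<n⇒m/n≡0 d<n) ⟩
        c + 0                 ≡⟨ +-identityʳ c ⟩
        c                     ∎)
      (begin
        (c * n + d) % n  ≡⟨ cong (_% n) (+-comm (c * n) d) ⟩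
        (d + c * n) % n  ≡⟨ [m+kn]%n≡m%n d c n ⟩
        d % n            ≡⟨ m<n⇒m%n≡m d<n ⟩
        d                ∎)

  χ : ∀ {A : Set} → Dec A → ℕ
  χ (yes _) = 1
  χ (no _)  = 0

  χ-true : ∀ {A : Set} (A? : Dec A) → A → χ A? ≡ 1
  χ-true (yes _) _ = refl
  χ-true (no ¬a) a = contradiction a ¬a

  χ-false : ∀ {A : Set} (A? : Dec A) → ¬ A → χ A? ≡ 0
  χ-false (yes a) ¬a = contradiction a ¬a
  χ-false (no _)  _  = refl

  χ-cong : ∀ {A B : Set} (A? : Dec A) (B? : Dec B) → A ⇔ B → χ A? ≡ χ B?
  χ-cong A? (yes b) A⇔B = χ-true A? (Equivalence.from A⇔B b)
  χ-cong A? (no ¬b) A⇔B = χ-false A? (¬b ∘ Equivalence.to A⇔B)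

  χ-× : ∀ {A B : Set} (A? : Dec A) (B? : Dec B) → χ (A? ×-dec B?) ≡ χ A? * χ B?
  χ-× (yes _) (yes _) = refl
  χ-× (yes _) (no _)  = refl
  χ-× (no _)  (yes _) = refl
  χ-× (no _)  (no _)  = refl

  χ-¬ : ∀ {A : Set} (A? : Dec A) → χ A? + χ (¬? A?) ≡ 1
  χ-¬ (yes _) = refl
  χ-¬ (no _)  = refl

  ∑-¬ : ∀ n {P : ℕ → Set} (P? : Decidable P) → ∑[ x < n ] χ (P? x) + ∑[ x < n ] χ (¬? (P? x)) ≡ n
  ∑-¬ zero    P? = refl
  ∑-¬ (suc n) P? = begin
    (a + s) + (b + s′)   ≡⟨ interchange a s b s′ ⟩
    (a + b) + (s + s′)   ≡⟨ cong₂ _+_ (χ-¬ (P? 0)) (∑-¬ n (P? ∘ suc)) ⟩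
    suc n                ∎
    where
    open ≡-Reasoning
    a = χ (P? 0)
    b = χ (¬? (P? 0))
    s = ∑[ x < n ] χ (P? (suc x))
    s′ = ∑[ x < n ] χ (¬? (P? (suc x)))
    interchange : ∀ a s b s′ → (a + s) + (b + s′) ≡ (a + b) + (s + s′)
    interchange = solve-∀

  ∑-unique : ∀ n {P : ℕ → Set} (P? : Decidable P) {x₀} → x₀ < n → P x₀ →
    (∀ {x} → x < n → P x → x ≡ x₀) → ∑[ x < n ] χ (P? x) ≡ 1
  ∑-unique (suc n) P? {zero}   _         p unique = cong₂ _+_ (χ-true (P? 0) p)
    (∑-zero n (λ {x} x<n → χ-false (P? (suc x)) (λ px → 1+n≢0 (unique (s<s x<n) px))))
  ∑-unique (suc n) P? {suc x₀} (s<s x₀<n) p unique = cong₂ _+_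
    (χ-false (P? 0) (λ p0 → 1+n≢0 (sym (unique z<s p0))))
    (∑-unique n (P? ∘ suc) x₀<n p (λ x<n px → suc-injective (unique (s<s x<n) px)))

  length-filter-applyUpTo : ∀ {P : ℕ → Set} (P? : Decidable P) f n →
    length (filter P? (applyUpTo f n)) ≡ ∑[ x < n ] χ (P? (f x))
  length-filter-applyUpTo P? f zero = refl
  length-filter-applyUpTo P? f (suc n) with P? (f 0)
  ... | yes _ = cong suc (length-filter-applyUpTo P? (f ∘ suc) n)
  ... | no  _ = length-filter-applyUpTo P? (f ∘ suc) n

  -- Residue classes

  affine-class : ∀ {v} .{{_ : NonZero v}} {a} → Coprime a v → ∀ b c →
    ∃[ x₀ ] x₀ < v × (∀ x → (a * x + b ≡ c [mod v ]) ⇔ (x ≡ x₀ [mod v ]))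
  affine-class {v} {a} a⊥v b c
    -- The term `c + b * pred v` represents c - b modulo `v`.
    with x₀ , x₀<v , ax₀≡ ← *-solveᵐ a⊥v (c + b * pred v)
    = x₀ , x₀<v , λ x → mk⇔
      (λ ax+b≡c → *-cancelˡᵐ a⊥v {x} {x₀}
        (+-cancelʳᵐ b {a * x} {a * x₀} (trans ax+b≡c (sym ax₀+b≡c))))
      (λ x≡x₀ → trans (+-congᵐ {a = a * x} {a * x₀} {b} (*-congˡᵐ a {x} {x₀} x≡x₀) refl) ax₀+b≡c)
    where
    open ≡-Reasoning
    regroup : ∀ c b k → c + b * k + b ≡ c + b * suc k
    regroup = solve-∀
    ax₀+b≡c : a * x₀ + b ≡ c [mod v ]
    ax₀+b≡c = begin
      (a * x₀ + b) % v              ≡⟨ +-congᵐ {a = a * x₀} {c + b * pred v} {b} ax₀≡ refl ⟩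
      (c + b * pred v + b) % v      ≡⟨ cong (_% v) (regroup c b (pred v)) ⟩
      (c + b * suc (pred v)) % v    ≡⟨ cong (λ k → (c + b * k) % v) (suc-pred v) ⟩
      (c + b * v) % v               ≡⟨ [m+kn]%n≡m%n c b v ⟩
      c % v                         ∎

  -- The predicate stays abstract because two classes are counted this way: the digits satisfying
  -- `Keeps` and the starting points satisfying `First`.
  module ResidueClass {v : ℕ} .{{_ : NonZero v}} {P : ℕ → Set} (P? : Decidable P)
    {x₀ : ℕ} (x₀<v : x₀ < v) (P⇔ : ∀ x → P x ⇔ (x ≡ x₀ [mod v ])) where

    open Equivalence

    count : ℕ → ℕ → ℕ
    count s m = ∑[ x < m ] χ (P? (s + x))

    shift-period : ∀ x → χ (P? (x + v)) ≡ χ (P? x)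
    shift-period x = χ-cong (P? (x + v)) (P? x) (mk⇔
      (λ p → from (P⇔ x) (trans (sym ([m+n]%n≡m%n x v)) (to (P⇔ (x + v)) p)))
      (λ p → from (P⇔ (x + v)) (trans ([m+n]%n≡m%n x v) (to (P⇔ x) p))))

    count-suc : ∀ s m → count s (suc m) ≡ χ (P? s) + count (suc s) m
    count-suc s m = cong₂ _+_ (cong (χ ∘ P?) (+-identityʳ s))
      (∑-cong m (λ {x} _ → cong (χ ∘ P?) (+-suc s x)))

    count-split : ∀ s m n → count s (m + n) ≡ count s m + count (s + m) n
    count-split s m n = trans (∑-split m n _)
      (cong (count s m +_) (∑-cong n (λ {x} _ → cong (χ ∘ P?) (sym (+-assoc s m x)))))

    -- Sliding the window of length `v` by one drops `s` and gains `s + v`, on which the predicate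
    -- agrees; so the count is that of the window [0, v).
    count-period : ∀ s → count s v ≡ 1
    count-period zero = ∑-unique v P? x₀<v (from (P⇔ x₀) refl)
      (λ {x} x<v p → trans (sym (m<n⇒m%n≡m x<v)) (trans (to (P⇔ x) p) (m<n⇒m%n≡m x₀<v)))
    count-period (suc s) = +-cancelˡ-≡ (χ (P? s)) _ _ (begin
      χ (P? s) + count (suc s) v     ≡⟨ count-suc s v ⟨
      count s (suc v)                ≡⟨ cong (count s) (+-comm 1 v) ⟩
      count s (v + 1)                ≡⟨ count-split s v 1 ⟩
      count s v + count (s + v) 1    ≡⟨ cong₂ _+_ (count-period s) (trans (count-suc (s + v) 0) (+-identityʳ _)) ⟩
      1 + χ (P? (s + v))             ≡⟨ cong (1 +_) (shift-period s) ⟩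
      1 + χ (P? s)                   ≡⟨ +-comm 1 _ ⟩
      χ (P? s) + 1                   ∎)
      where open ≡-Reasoning

    count-periods : ∀ s k → count s (k * v) ≡ k
    count-periods s zero    = refl
    count-periods s (suc k) = trans (count-split s v (k * v))
      (cong₂ _+_ (count-period s) (count-periods (s + v) k))

    count-lower : ∀ s k {m} → k * v ≤ m → k ≤ count s m
    count-lower s k kv≤m = ≤-trans (≤-reflexive (sym (count-periods s k))) (∑-monoˡ _ kv≤m)

    count-upper : ∀ s k {m} → m ≤ k * v → count s m ≤ k
    count-upper s k m≤kv = ≤-trans (∑-monoˡ _ m≤kv) (≤-reflexive (count-periods s k))

    private
      complement : ℕ → ℕ
      complement m = ∑[ x < m ] χ (¬? (P? x))

      pred-*-+ : ∀ m → (v ∸ 1) * m + m ≡ m * v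
      pred-*-+ m = begin
        (v ∸ 1) * m + m   ≡⟨ +-comm _ m ⟩
        suc (v ∸ 1) * m   ≡⟨ cong (_* m) (m+[n∸m]≡n (>-nonZero⁻¹ v)) ⟩
        v * m             ≡⟨ *-comm v m ⟩
        m * v             ∎
        where open ≡-Reasoning

    -- The hypothesis rearranges to `m ≤ (m ∸ k) * v`, so the class itself has at most `m ∸ k`
    -- members below `m` and leaves at least `k` to its complement.
    complement-lower : ∀ k {m} → k * v ≤ (v ∸ 1) * m → k ≤ complement m
    complement-lower k {m} kv≤ = +-cancelˡ-≤ (count 0 m) k (complement m) (begin
      count 0 m + k               ≤⟨ +-monoˡ-≤ k (count-upper 0 (m ∸ k) m≤ev) ⟩
      m ∸ k + k                   ≡⟨ m∸n+n≡m k≤m ⟩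
      m                           ≡⟨ ∑-¬ m P? ⟨
      count 0 m + complement m    ∎)
      where
      open ≤-Reasoning
      kv+m≤mv : k * v + m ≤ m * v
      kv+m≤mv = ≤-trans (+-monoˡ-≤ m kv≤) (≤-reflexive (pred-*-+ m))
      k≤m : k ≤ m
      k≤m = *-cancelʳ-≤ k m v (≤-trans (m≤m+n _ m) kv+m≤mv)
      m≤ev : m ≤ (m ∸ k) * v
      m≤ev = ≤-trans (m+n≤o⇒m≤o∸n m (≤-trans (≤-reflexive (+-comm m _)) kv+m≤mv)) (≤-reflexive (sym (*-distribʳ-∸ v m k)))

    complement-upper : ∀ k {m} → (v ∸ 1) * m ≤ k * v → complement m ≤ k
    complement-upper k {m} ≤kv = +-cancelˡ-≤ (count 0 m) (complement m) k (begin
      count 0 m + complement m    ≡⟨ ∑-¬ m P? ⟩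
      -- This also holds for `k` above `m`, where the truncated difference is 0.
      m                           ≤⟨ m≤n+m∸n m k ⟩
      k + (m ∸ k)                 ≡⟨ +-comm k _ ⟩
      m ∸ k + k                   ≤⟨ +-monoˡ-≤ k (count-lower 0 (m ∸ k) ev≤m) ⟩
      count 0 m + k               ∎)
      where
      open ≤-Reasoning
      ev≤m : (m ∸ k) * v ≤ m
      ev≤m = begin
        (m ∸ k) * v             ≡⟨ *-distribʳ-∸ v m k ⟩
        m * v ∸ k * v           ≡⟨ cong (_∸ k * v) (pred-*-+ m) ⟨
        (v ∸ 1) * m + m ∸ k * v ≤⟨ ∸-monoˡ-≤ (k * v) (+-monoˡ-≤ m ≤kv) ⟩
        k * v + m ∸ k * v       ≡⟨ m+n∸m≡n (k * v) m ⟩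
        m                       ∎

  -- Ceiling division

  ⌈_/_⌉ : ∀ a n .{{_ : NonZero n}} → ℕ
  ⌈ a / n ⌉ = (a + pred n) / n

  module _ {n : ℕ} .{{_ : NonZero n}} where

    -- Together with `≤⇒⌈/⌉≤` this is the Galois connection between rounding up after division by
    -- `n` and multiplication by `n`. All bounds on the cut points below come from it.
    ⌈/⌉≤⇒ : ∀ {a x} → ⌈ a / n ⌉ ≤ x → a ≤ x * n
    ⌈/⌉≤⇒ {a} {x} c≤x = +-cancelʳ-≤ (pred n) a (x * n) (begin
      a + pred n                              ≡⟨ m≡m%n+[m/n]*n (a + pred n) n ⟩
      (a + pred n) % n + ⌈ a / n ⌉ * n        ≤⟨ +-mono-≤ (suc[m]≤n⇒m≤pred[n] (m%n<n (a + pred n) n)) (*-monoˡ-≤ n c≤x) ⟩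
      pred n + x * n                          ≡⟨ +-comm (pred n) _ ⟩
      x * n + pred n                          ∎)
      where open ≤-Reasoning

    ≤⇒⌈/⌉≤ : ∀ {a x} → a ≤ x * n → ⌈ a / n ⌉ ≤ x
    ≤⇒⌈/⌉≤ {a} {x} a≤xn = m<1+n⇒m≤n (m<n*o⇒m/o<n (begin-strict
      a + pred n        ≤⟨ +-monoˡ-≤ (pred n) a≤xn ⟩
      x * n + pred n    <⟨ +-monoʳ-< (x * n) (≤-reflexive (suc-pred n)) ⟩
      x * n + n         ≡⟨ +-comm (x * n) n ⟩
      suc x * n         ∎))
      where open ≤-Reasoning

  -- Equipartition of an interval

  -- The x < p with ⌊x N / p⌋ ≡ c are those with e c ≤ x < e (suc c).
  module Partition {p N q r : ℕ} .{{_ : NonZero p}} .{{_ : NonZero N}}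
    (p≡qN+r : p ≡ q * N + r) (r≤N : r ≤ N) where

    e : ℕ → ℕ
    e c = ⌈ c * p / N ⌉

    e[0]≡0 : e 0 ≡ 0
    e[0]≡0 = n≤0⇒n≡0 (≤⇒⌈/⌉≤ z≤n)

    e[N]≡p : e N ≡ p
    e[N]≡p = ≤-antisym (≤⇒⌈/⌉≤ (≤-reflexive (*-comm N p)))
      (*-cancelʳ-≤ p (e N) N (≤-trans (≤-reflexive (*-comm p N)) (⌈/⌉≤⇒ ≤-refl)))

    -- From q N ≤ p follows q N + c p ≤ (c + 1) p ≤ `e (suc c) * N`. So `e (suc c) ∸ q` times N
    -- still reaches c p, and `e c` is the least number with that property.
    q+e≤e : ∀ c → q + e c ≤ e (suc c)
    q+e≤e c = begin
      q + e c                ≤⟨ +-monoʳ-≤ q (≤⇒⌈/⌉≤ cp≤) ⟩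
      q + (e (suc c) ∸ q)    ≡⟨ m+[n∸m]≡n q≤e ⟩
      e (suc c)              ∎
      where
      open ≤-Reasoning
      qN≤p : q * N ≤ p
      qN≤p = ≤-trans (m≤m+n _ r) (≤-reflexive (sym p≡qN+r))
      qN+cp≤eN : q * N + c * p ≤ e (suc c) * N
      qN+cp≤eN = ≤-trans (+-monoˡ-≤ (c * p) qN≤p) (⌈/⌉≤⇒ ≤-refl)
      q≤e : q ≤ e (suc c)
      q≤e = *-cancelʳ-≤ q (e (suc c)) N (m+n≤o⇒m≤o (q * N) qN+cp≤eN)
      cp≤ : c * p ≤ (e (suc c) ∸ q) * N
      cp≤ = begin
        c * p                      ≤⟨ m+n≤o⇒m≤o∸n (c * p) (≤-trans (≤-reflexive (+-comm (c * p) _)) qN+cp≤eN) ⟩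
        e (suc c) * N ∸ q * N      ≡⟨ *-distribʳ-∸ N (e (suc c)) q ⟨
        (e (suc c) ∸ q) * N        ∎

    e-mono : ∀ c → e c ≤ e (suc c)
    e-mono c = m+n≤o⇒n≤o q (q+e≤e c)

    width : ℕ → ℕ
    width c = e (suc c) ∸ e c

    width-lower : ∀ c → q ≤ width c
    width-lower c = m+n≤o⇒m≤o∸n q (q+e≤e c)

    width-upper : ∀ c → width c ≤ q + 1
    width-upper c = m≤n+o⇒m∸n≤o (e (suc c)) (e c) (≤⇒⌈/⌉≤ (begin
      p + c * p                   ≤⟨ +-mono-≤ p≤[q+1]N (⌈/⌉≤⇒ {a = c * p} ≤-refl) ⟩
      (q + 1) * N + e c * N       ≡⟨ +-comm _ (e c * N) ⟩
      e c * N + (q + 1) * N       ≡⟨ *-distribʳ-+ N (e c) (q + 1) ⟨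
      (e c + (q + 1)) * N         ∎))
      where
      open ≤-Reasoning
      p≤[q+1]N : p ≤ (q + 1) * N
      p≤[q+1]N = begin
        p                ≡⟨ p≡qN+r ⟩
        q * N + r        ≤⟨ +-monoʳ-≤ (q * N) r≤N ⟩
        q * N + N        ≡⟨ cong (q * N +_) (*-identityˡ N) ⟨
        q * N + 1 * N    ≡⟨ *-distribʳ-+ N q 1 ⟨
        (q + 1) * N      ∎

    -- For x = `e c + y`, the Galois connection turns `e c` ≤ x into c p ≤ x N, and x < `e (suc c)`
    -- into x N < (c + 1) p.
    cell : ∀ c {y} → y < width c → N * (e c + y) / p ≡ c
    cell c {y} y<w = ≤-antisym
      (m<1+n⇒m≤n (m<n*o⇒m/o<n (subst (_< suc c * p) (*-comm x N) (≰⇒> λ [1+c]p≤xN → <⇒≱ x<e (≤⇒⌈/⌉≤ [1+c]p≤xN)))))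
      (subst (_≤ N * x / p) (m*n/n≡m c p) (/-monoˡ-≤ p (subst (c * p ≤_) (*-comm x N) (⌈/⌉≤⇒ (m≤m+n (e c) y)))))
      where
      x = e c + y
      x<e : x < e (suc c)
      x<e = subst (x <_) (m+[n∸m]≡n (e-mono c)) (+-monoʳ-< (e c) y<w)

    ∑-cells : ∀ f → ∑ p f ≡ ∑[ c < N ] ∑[ y < width c ] f (e c + y)
    ∑-cells f = trans (cong (λ k → ∑ k f) (sym e[N]≡p)) (∑-partition N e f e[0]≡0 e-mono)

  -- The orbit of a primitive root

  -- The head of `xs` is cut out of `ys`. Since it does not recur in `xs`, the remaining entries are
  -- still found in what is left of `ys`, and the lengths still agree.
  Unique-⊆⇒↭ : ∀ {A : Set} {xs ys : List A} → Unique xs → (∀ {x} → x ∈ xs → x ∈ ys) →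
    length ys ≡ length xs → xs ↭ ys
  Unique-⊆⇒↭ {xs = []}     {[]} _ _ _ = ↭-refl
  Unique-⊆⇒↭ {xs = x ∷ xs} (x∉xs ∷ xs!) xs⊆ys eq
    with hs , ts , refl ← ∈-∃++ (xs⊆ys (here refl))
    = ↭-trans (↭-prep x (Unique-⊆⇒↭ xs! xs⊆ eq′)) (↭-sym (shift x hs ts))
    where
    xs⊆ : ∀ {z} → z ∈ xs → z ∈ hs ++ ts
    xs⊆ z∈xs with ∈-resp-↭ (shift x hs ts) (xs⊆ys (there z∈xs))
    ... | here z≡x = contradiction (sym z≡x) (All.lookup x∉xs z∈xs)
    ... | there z∈ = z∈
    eq′ : length (hs ++ ts) ≡ length xs
    eq′ = suc-injective (trans (sym (↭-length (shift x hs ts))) eq)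

  module Orbit {m g : ℕ} (p-prime : Prime (suc m)) (g-root : PrimitiveRoot (suc m) g) where

    p = suc m

    g⊥p : Coprime g p
    g⊥p = gcd≡1⇒coprime (proj₁ g-root)

    pow : ℕ → ℕ
    pow i = g ^ i % p

    pow≢0 : ∀ i → pow i ≢ 0
    pow≢0 zero    = subst (_≢ 0) (sym (m<n⇒m%n≡m (nonTrivial⇒n>1 p {{prime⇒nonTrivial p-prime}}))) λ ()
    pow≢0 (suc i) gⁱ⁺¹≡0 = pow≢0 i (*-cancelˡᵐ g⊥p {g ^ i} {0} (trans gⁱ⁺¹≡0 (cong (_% p) (sym (*-zeroʳ g)))))

    pow-cancelˡ : ∀ i {d} → pow (i + d) ≡ pow i → pow d ≡ pow 0
    pow-cancelˡ zero        eq = eq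
    pow-cancelˡ (suc i) {d} eq = pow-cancelˡ i (*-cancelˡᵐ g⊥p {g ^ (i + d)} {g ^ i} eq)

    pow-*-period : ∀ {d} → pow d ≡ pow 0 → ∀ k i → pow (i + k * d) ≡ pow i
    pow-*-period {d} period k i = begin
      g ^ (i + k * d) % p        ≡⟨ cong (_% p) (^-distribˡ-+-* g i (k * d)) ⟩
      g ^ i * g ^ (k * d) % p    ≡⟨ cong (λ j → g ^ i * g ^ j % p) (*-comm k d) ⟩
      g ^ i * g ^ (d * k) % p    ≡⟨ cong (λ j → g ^ i * j % p) (^-*-assoc g d k) ⟨
      g ^ i * (g ^ d) ^ k % p    ≡⟨ *-congˡᵐ (g ^ i) {(g ^ d) ^ k} {1 ^ k} (^-congᵐ {a = g ^ d} {1} period k) ⟩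
      g ^ i * 1 ^ k % p          ≡⟨ cong (λ j → g ^ i * j % p) (^-zeroˡ k) ⟩
      g ^ i * 1 % p              ≡⟨ cong (_% p) (*-identityʳ (g ^ i)) ⟩
      g ^ i % p                  ∎
      where open ≡-Reasoning

    private
      slot< : ∀ (i : Fin p) → pred (pow (toℕ i)) < m
      slot< i = ≤-trans (≤-reflexive (suc-pred (pow (toℕ i)) {{≢-nonZero (pow≢0 (toℕ i))}}))
        (m<1+n⇒m≤n (m%n<n (g ^ toℕ i) p))

      slot : Fin p → Fin m
      slot i = fromℕ< (slot< i)

      slot≡⇒pow≡ : ∀ i j → slot i ≡ slot j → pow (toℕ i) ≡ pow (toℕ j)
      slot≡⇒pow≡ i j eq = begin
        pow (toℕ i)               ≡⟨ suc-pred _ {{≢-nonZero (pow≢0 (toℕ i))}} ⟨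
        suc (pred (pow (toℕ i)))  ≡⟨ cong suc (fromℕ<-injective _ _ (slot< i) (slot< j) eq) ⟩
        suc (pred (pow (toℕ j)))  ≡⟨ suc-pred _ {{≢-nonZero (pow≢0 (toℕ j))}} ⟩
        pow (toℕ j)               ∎
        where open ≡-Reasoning

    -- Two of the p powers g ^ 0, …, g ^ m share one of the m nonzero residues.
    period : ∃[ d ] suc d ≤ m × pow (suc d) ≡ pow 0
    period
      with i , j , i<j , eq ← pigeonhole (n<1+n m) slot
      with d , 1+i+d≡j ← m≤n⇒∃[o]m+o≡n i<j
      with i+1+d≡j ← trans (+-suc (toℕ i) d) 1+i+d≡j
      = d
      , ≤-trans (m≤n+m (suc d) (toℕ i)) (≤-trans (≤-reflexive i+1+d≡j) (toℕ≤pred[n] j))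
      , pow-cancelˡ (toℕ i) (trans (cong pow i+1+d≡j) (sym (slot≡⇒pow≡ i j eq)))

    -- Primitivity gives an exponent of unknown size; reducing it modulo a period of length at most
    -- `m` brings it into the range 1 to `m`.
    pow-surjective : ∀ {x} → x < m → ∃[ i ] i < m × suc x ≡ pow (suc i)
    pow-surjective {x} x<m
      with d , d<m , gᵈ⁺¹≡1 ← period
      with k , gᵏ≡1+x ← proj₂ g-root (suc x) (trans (gcd-comm (suc x) p) (coprime⇒gcd≡1 (prime⇒coprime p-prime (s<s x<m))))
      = exponent d<m gᵈ⁺¹≡1 (k % suc d) (m%n<n k (suc d)) (begin
        suc x                                 ≡⟨ m<n⇒m%n≡m (s<s x<m) ⟨
        suc x % p                             ≡⟨ gᵏ≡1+x ⟨
        pow k                                 ≡⟨ cong pow (m≡m%n+[m/n]*n k (suc d)) ⟩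
        pow (k % suc d + k / suc d * suc d)   ≡⟨ pow-*-period {suc d} gᵈ⁺¹≡1 (k / suc d) (k % suc d) ⟩
        pow (k % suc d)                       ∎)
      where
      open ≡-Reasoning
      exponent : ∀ {d} → suc d ≤ m → pow (suc d) ≡ pow 0 → ∀ i → i < suc d → suc x ≡ pow i →
        ∃[ i ] i < m × suc x ≡ pow (suc i)
      -- Exponent 0 lies outside the range 1 to `m`; the full period `suc d` gives the same power.
      exponent {d} d<m gᵈ⁺¹≡1 zero    _         eq = d , d<m , trans eq (sym gᵈ⁺¹≡1)
      exponent     d<m gᵈ⁺¹≡1 (suc i) (s<s i<d) eq = i , <-trans i<d d<m , eq

    -- The `m` powers cover the `m` distinct nonzero residues, so by equal lengths the two lists are
    -- permutations of each other; injectivity comes along with this.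
    ∑-orbit : ∀ f → ∑[ i < m ] f (pow (suc i)) ≡ ∑[ x < m ] f (suc x)
    ∑-orbit f = begin
      sum (applyUpTo (f ∘ pow ∘ suc) m)         ≡⟨ cong sum (map-applyUpTo (pow ∘ suc) f m) ⟨
      sum (map f (applyUpTo (pow ∘ suc) m))     ≡⟨ sum-↭ (map⁺ f orbit) ⟨
      sum (map f (applyUpTo suc m))             ≡⟨ cong sum (map-applyUpTo suc f m) ⟩
      sum (applyUpTo (f ∘ suc) m)               ∎
      where
      open ≡-Reasoning
      orbit : applyUpTo suc m ↭ applyUpTo (pow ∘ suc) m
      orbit = Unique-⊆⇒↭
        (applyUpTo⁺₁ suc m (λ i<j _ → <⇒≢ i<j ∘ suc-injective))
        (λ x∈ → case ∈-applyUpTo⁻ suc x∈ of λ where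
          (x , x<m , refl) → case pow-surjective x<m of λ where
            (i , i<m , eq) → subst (_∈ applyUpTo (pow ∘ suc) m) (sym eq) (∈-applyUpTo⁺ (pow ∘ suc) i<m))
        (trans (length-applyUpTo (pow ∘ suc) m) (sym (length-applyUpTo suc m)))

  -- Base-g digits

  module Digits (p g v b : ℕ) .{{_ : NonZero p}} .{{_ : NonZero g}} .{{_ : NonZero v}} (g⊥v : Coprime g v) where

    -- The digits that carry a residue ≡ b to a residue ≡ b.
    Keeps : ℕ → Set
    Keeps d = p * d + b ≡ g * b [mod v ]

    keeps? : Decidable Keeps
    keeps? d = p * d + b ≡ g * b [mod v ]?

    -- The base-g digit of weight `g ^ s`, which is the leading digit when `y` is below `g ^ suc s`.
    top : ℕ → ℕ → ℕ
    top zero    y = y % g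
    top (suc s) y = top s (y / g)

    -- With t = s + 1, the argument is read as the digit string d_1, ..., d_t. Digits are stripped
    -- from the end, so the base case is the digit d_1 at which the run is entered.
    Inner : ℕ → ℕ → Set
    Inner zero    y = ¬ Keeps (y % g)
    Inner (suc s) y = Inner s (y / g) × Keeps (y % g)

    inner? : ∀ s → Decidable (Inner s)
    inner? zero    y = ¬? (keeps? (y % g))
    inner? (suc s) y = inner? s (y / g) ×-dec keeps? (y % g)

    Word : ℕ → ℕ → Set
    Word s c = Inner s (c / g) × ¬ Keeps (c % g)

    word? : ∀ s → Decidable (Word s)
    word? s c = inner? s (c / g) ×-dec ¬? (keeps? (c % g))

    -- The summand 0 gives the congruence the shape treated by affine-class.
    First : ℕ → ℕ → ℕ → Set
    First s c x = g * x + 0 ≡ p * top s (c / g) + b [mod v ]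

    first? : ∀ s c → Decidable (First s c)
    first? s c x = g * x + 0 ≡ p * top s (c / g) + b [mod v ]?

    κ κ̄ : ℕ
    κ  = ∑[ d < g ] χ (keeps? d)
    κ̄  = ∑[ d < g ] χ (¬? (keeps? d))

    -- The conditions concern one digit each, so splitting off the last digit by `∑-digits`
    -- contributes one factor `κ` per step.
    ∑-inner : ∀ s → ∑[ y < g ^ suc s ] χ (inner? s y) ≡ κ̄ * κ ^ s
    ∑-inner zero = begin
      ∑[ y < g * 1 ] χ (¬? (keeps? (y % g)))    ≡⟨ cong (λ k → ∑[ y < k ] χ (¬? (keeps? (y % g)))) (*-identityʳ g) ⟩
      ∑[ y < g ] χ (¬? (keeps? (y % g)))        ≡⟨ ∑-cong g (λ y<g → cong (χ ∘ ¬? ∘ keeps?) (m<n⇒m%n≡m y<g)) ⟩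
      κ̄                                         ≡⟨ *-identityʳ κ̄ ⟨
      κ̄ * 1                                     ∎
      where open ≡-Reasoning
    ∑-inner (suc s) = begin
      ∑[ y < g * g ^ suc s ] χ (inner? (suc s) y)
        ≡⟨ cong (λ k → ∑[ y < k ] χ (inner? (suc s) y)) (*-comm g (g ^ suc s)) ⟩
      ∑[ y < g ^ suc s * g ] χ (inner? (suc s) y)
        ≡⟨ ∑-cong (g ^ suc s * g) (λ {y} _ → χ-× (inner? s (y / g)) (keeps? (y % g))) ⟩
      ∑[ y < g ^ suc s * g ] (χ (inner? s (y / g)) * χ (keeps? (y % g)))
        ≡⟨ ∑-digits (g ^ suc s) g (χ ∘ inner? s) (χ ∘ keeps?) ⟩
      (∑[ y < g ^ suc s ] χ (inner? s y)) * κ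
        ≡⟨ cong (_* κ) (∑-inner s) ⟩
      κ̄ * κ ^ s * κ
        ≡⟨ *-assoc κ̄ (κ ^ s) κ ⟩
      κ̄ * (κ ^ s * κ)
        ≡⟨ cong (κ̄ *_) (*-comm (κ ^ s) κ) ⟩
      κ̄ * κ ^ suc s
        ∎
      where open ≡-Reasoning

    ∑-word : ∀ s → ∑[ c < g ^ suc (suc s) ] χ (word? s c) ≡ κ ^ s * κ̄ ^ 2
    ∑-word s = begin
      ∑[ c < g * g ^ suc s ] χ (word? s c)
        ≡⟨ cong (λ k → ∑[ c < k ] χ (word? s c)) (*-comm g (g ^ suc s)) ⟩
      ∑[ c < g ^ suc s * g ] χ (word? s c)
        ≡⟨ ∑-cong (g ^ suc s * g) (λ {c} _ → χ-× (inner? s (c / g)) (¬? (keeps? (c % g)))) ⟩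
      ∑[ c < g ^ suc s * g ] (χ (inner? s (c / g)) * χ (¬? (keeps? (c % g))))
        ≡⟨ ∑-digits (g ^ suc s) g (χ ∘ inner? s) (χ ∘ ¬? ∘ keeps?) ⟩
      (∑[ y < g ^ suc s ] χ (inner? s y)) * κ̄
        ≡⟨ cong (_* κ̄) (∑-inner s) ⟩
      κ̄ * κ ^ s * κ̄
        ≡⟨ regroup κ̄ (κ ^ s) ⟩
      κ ^ s * κ̄ ^ 2
        ∎
      where
      open ≡-Reasoning
      regroup : ∀ a k → a * k * a ≡ k * (a * (a * 1))
      regroup = solve-∀

    -- Orbits as long division in base g

    module _ (x : ℕ) where

      -- Long division of `x` by `p` in base g: `X j` is the j-th remainder and `Y j` the quotient.
      -- For `x` below `p`, `Y j` consists of the first j digits of x / p after the point.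
      X Y : ℕ → ℕ
      X j = g ^ j * x % p
      Y j = g ^ j * x / p

      private
        -- One step of the long division: the old quotient moves up one place and the new last digit
        -- is the quotient of `g * X j` by `p`.
        Y-suc : ∀ j → Y (suc j) ≡ g * X j / p + Y j * g
        Y-suc j = begin
          g * g ^ j * x / p                      ≡⟨ /-congˡ (*-assoc g (g ^ j) x) ⟩
          g * z / p                              ≡⟨ /-congˡ (cong (g *_) (m≡m%n+[m/n]*n z p)) ⟩
          g * (X j + Y j * p) / p                ≡⟨ /-congˡ (regroup g (X j) (Y j) p) ⟩
          (g * X j + Y j * g * p) / p            ≡⟨ +-distrib-/-∣ʳ (g * X j) (divides-refl (Y j * g)) ⟩
          g * X j / p + Y j * g * p / p          ≡⟨ cong (g * X j / p +_) (m*n/n≡m (Y j * g) p) ⟩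
          g * X j / p + Y j * g                  ∎
          where
          open ≡-Reasoning
          z = g ^ j * x
          regroup : ∀ g a y p → g * (a + y * p) ≡ g * a + y * g * p
          regroup = solve-∀

        X-suc : ∀ j → X (suc j) ≡ g * X j % p
        X-suc j = begin
          g * g ^ j * x % p        ≡⟨ %-congˡ (*-assoc g (g ^ j) x) ⟩
          g * (g ^ j * x) % p      ≡⟨ *-congˡᵐ g {X j} {g ^ j * x} (m%n%n≡m%n (g ^ j * x) p) ⟨
          g * X j % p              ∎
          where open ≡-Reasoning

        digit<g : ∀ j → g * X j / p < g
        digit<g j = m<n*o⇒m/o<n (*-monoʳ-< g (m%n<n (g ^ j * x) p))

      Y-suc-% : ∀ j → Y (suc j) % g ≡ g * X j / p
      Y-suc-% j = trans (%-congˡ (Y-suc j))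
        (trans ([m+kn]%n≡m%n (g * X j / p) (Y j) g) (m<n⇒m%n≡m (digit<g j)))

      Y-suc-/ : ∀ j → Y (suc j) / g ≡ Y j
      Y-suc-/ j = begin
        Y (suc j) / g                          ≡⟨ /-congˡ (Y-suc j) ⟩
        (g * X j / p + Y j * g) / g            ≡⟨ +-distrib-/-∣ʳ (g * X j / p) (divides-refl (Y j)) ⟩
        g * X j / p / g + Y j * g / g          ≡⟨ cong₂ _+_ (m<n⇒m/n≡0 (digit<g j)) (m*n/n≡m (Y j) g) ⟩
        Y j                                    ∎
        where open ≡-Reasoning

      step : ∀ j → g * X j ≡ p * (Y (suc j) % g) + X (suc j)
      step j = begin
        g * X j                               ≡⟨ m≡m%n+[m/n]*n (g * X j) p ⟩
        g * X j % p + g * X j / p * p         ≡⟨ cong₂ (λ a d → a + d * p) (sym (X-suc j)) (sym (Y-suc-% j)) ⟩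
        X (suc j) + Y (suc j) % g * p         ≡⟨ +-comm (X (suc j)) _ ⟩
        Y (suc j) % g * p + X (suc j)         ≡⟨ cong (_+ X (suc j)) (*-comm _ p) ⟩
        p * (Y (suc j) % g) + X (suc j)       ∎
        where open ≡-Reasoning

      infix 4 _≈b
      _≈b : ℕ → Set
      a ≈b = a ≡ b [mod v ]

      step-≈b : ∀ j → X (suc j) ≈b ⇔ (g * X j ≡ p * (Y (suc j) % g) + b [mod v ])
      step-≈b j = mk⇔
        (λ X≈b → trans (cong (_% v) (step j)) (+-congᵐ {a = pd} {pd} {X (suc j)} refl X≈b))
        (λ eq → +-cancelˡᵐ pd {X (suc j)} {b} (trans (cong (_% v) (sym (step j))) eq))
        where pd = p * (Y (suc j) % g)

      keeps-next : ∀ j → X j ≈b → X (suc j) ≈b ⇔ Keeps (Y (suc j) % g)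
      keeps-next j X≈b = mk⇔
        (λ X′≈b → trans (sym (Equivalence.to (step-≈b j) X′≈b)) gX≡gb)
        (λ keeps → Equivalence.from (step-≈b j) (trans gX≡gb (sym keeps)))
        where
        gX≡gb : g * X j ≡ g * b [mod v ]
        gX≡gb = *-congˡᵐ g {X j} {b} X≈b

      -- The converse direction runs the recurrence backwards, cancelling `g` modulo `v` by
      -- coprimality.
      keeps-previous : ∀ j → X (suc j) ≈b → X j ≈b ⇔ Keeps (Y (suc j) % g)
      keeps-previous j X′≈b = mk⇔
        (λ X≈b → Equivalence.to (keeps-next j X≈b) X′≈b)
        (λ keeps → *-cancelˡᵐ g⊥v {X j} {b} (trans (Equivalence.to (step-≈b j) X′≈b) keeps))

      Run : ℕ → Set
      Run s = ¬ X 0 ≈b × (∀ {k} → k < suc s → X (suc k) ≈b)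

      -- The anchor is the first term `X 1` of the run: looking back, the first digit decides
      -- whether `X 0` avoids b; looking forward, each further digit decides whether the run goes
      -- on.
      run⇔ : ∀ s → Run s ⇔ (X 1 ≈b × Inner s (Y (suc s)))
      run⇔ zero = mk⇔
        (λ (X₀≉b , X≈b) → X≈b z<s , X₀≉b ∘ Equivalence.from (keeps-previous 0 (X≈b z<s)))
        (λ (X₁≈b , leaves) → leaves ∘ Equivalence.to (keeps-previous 0 X₁≈b) , λ where z<s → X₁≈b)
      run⇔ (suc s) = mk⇔
        (λ (X₀≉b , X≈b) →
          let X₁≈b , inner = Equivalence.to (run⇔ s) (X₀≉b , X≈b ∘ m<n⇒m<1+n) in
          X₁≈b , subst (Inner s) (sym (Y-suc-/ (suc s))) inner
               , Equivalence.to (keeps-next (suc s) (X≈b (m<n⇒m<1+n (n<1+n s)))) (X≈b (n<1+n (suc s))))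
        (λ (X₁≈b , inner , keeps) →
          let X₀≉b , X≈b = Equivalence.from (run⇔ s) (X₁≈b , subst (Inner s) (Y-suc-/ (suc s)) inner)
          in X₀≉b , extend X≈b (Equivalence.from (keeps-next (suc s) (X≈b (n<1+n s))) keeps))
        where
        extend : (∀ {k} → k < suc s → X (suc k) ≈b) → X (suc (suc s)) ≈b →
          ∀ {k} → k < suc (suc s) → X (suc k) ≈b
        extend X≈b last {k} k<2+s with m≤n⇒m<n∨m≡n (m<1+n⇒m≤n k<2+s)
        ... | inj₁ k<1+s = X≈b k<1+s
        ... | inj₂ refl  = last

      top-Y : ∀ s → top s (Y (suc s)) ≡ Y 1 % g
      top-Y zero    = refl
      top-Y (suc s) = trans (cong (top s) (Y-suc-/ (suc s))) (top-Y s)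

      -- Since `X 0` is `x` itself, the condition on `X 1` becomes a congruence for `x` in which
      -- only the leading digit enters. The last digit of `Y (suc (suc s))` decides whether the run
      -- stops.
      maximalRun⇔ : x < p → ∀ s →
        (Run s × ¬ X (suc (suc s)) ≈b) ⇔ (First s (Y (suc (suc s))) x × Word s (Y (suc (suc s))))
      maximalRun⇔ x<p s = mk⇔
        (λ (run , Xₛ≉b) →
          let X₁≈b , inner = Equivalence.to (run⇔ s) run in
            trans (cong (_% v) (sym gX₀)) (trans (Equivalence.to (step-≈b 0) X₁≈b) (cong (_% v) pd₁))
          , subst (Inner s) (sym (Y-suc-/ (suc s))) inner
          , Xₛ≉b ∘ Equivalence.from (keeps-next (suc s) (proj₂ run (n<1+n s))))
        (λ (first , inner , leaves) →
          let X₁≈b = Equivalence.from (step-≈b 0) (trans (cong (_% v) gX₀) (trans first (cong (_% v) (sym pd₁))))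
              run  = Equivalence.from (run⇔ s) (X₁≈b , subst (Inner s) (Y-suc-/ (suc s)) inner)
          in run , leaves ∘ Equivalence.to (keeps-next (suc s) (proj₂ run (n<1+n s))))
        where
        gX₀ : g * X 0 ≡ g * x + 0
        gX₀ = trans (cong (g *_) (trans (cong (_% p) (*-identityˡ x)) (m<n⇒m%n≡m x<p))) (sym (+-identityʳ _))
        pd₁ : p * (Y 1 % g) + b ≡ p * top s (Y (suc (suc s)) / g) + b
        pd₁ = cong (λ d → p * d + b) (sym (trans (cong (top s) (Y-suc-/ (suc s))) (top-Y s)))

  -- Counting the starting points of runs of length t = s + 1

  module Count {m g v r : ℕ} (b s q : ℕ) .{{_ : NonZero g}} .{{_ : NonZero v}}
    (p-prime : Prime (suc m)) (g-root : PrimitiveRoot (suc m) g)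
    (g⊥v : Coprime g v) (p⊥v : Coprime (suc m) v)
    (p≡qN+r : suc m ≡ q * g ^ suc (suc s) + r) (r≤N : r ≤ g ^ suc (suc s)) where

    N : ℕ
    N = g ^ suc (suc s)

    open Digits (suc m) g v b g⊥v
    open Orbit p-prime g-root
    open Partition {N = N} {q} {{_}} {{m^n≢0 g (suc (suc s))}} p≡qN+r r≤N

    Good : ℕ → ℕ → Set
    Good c x = First s c x × Word s c

    good? : ∀ c → Decidable (Good c)
    good? c x = first? s c x ×-dec word? s c

    F : ℕ → ℕ
    F x = χ (good? (N * x / p) x)

    runAfter⇔ : ∀ i → RunAfter p g v b (suc s) i ⇔ Good (N * pow i / p) (pow i)
    runAfter⇔ i = mk⇔
      (λ (gⁱ≉b , gⁱ⁺ᵗ⁺¹≉b , run) → Equivalence.to maximal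
        ( ( subst ≉b (sym (trans (X-pow 0) (cong pow (+-identityʳ i)))) gⁱ≉b
          , λ k<t → subst ≈b (sym (X-pow _)) (All.applyUpTo⁻ suc (suc s) run k<t))
        , subst ≉b (sym (trans (X-pow (suc (suc s))) (cong pow last))) gⁱ⁺ᵗ⁺¹≉b))
      (λ good → let (X₀≉b , X≈b) , Xₜ₊₁≉b = Equivalence.from maximal good in
          subst ≉b (trans (X-pow 0) (cong pow (+-identityʳ i))) X₀≉b
        , subst ≉b (trans (X-pow (suc (suc s))) (cong pow last)) Xₜ₊₁≉b
        , All.applyUpTo⁺₁ suc (suc s) (λ k<t → subst ≈b (X-pow _) (X≈b k<t)))
      where
      ≈b ≉b : ℕ → Set
      ≈b a = a ≡ b [mod v ]
      ≉b a = ¬ a ≡ b [mod v ]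
      maximal = maximalRun⇔ (pow i) (m%n<n (g ^ i) p) s
      last : i + suc (suc s) ≡ i + suc s + 1
      last = trans (cong (i +_) (+-comm 1 (suc s))) (sym (+-assoc i (suc s) 1))
      X-pow : ∀ j → X (pow i) j ≡ pow (i + j)
      X-pow j = begin
        g ^ j * pow i % p      ≡⟨ *-congˡᵐ (g ^ j) {pow i} {g ^ i} (m%n%n≡m%n (g ^ i) p) ⟩
        g ^ j * g ^ i % p      ≡⟨ %-congˡ (^-distribˡ-+-* g j i) ⟨
        g ^ (j + i) % p        ≡⟨ cong pow (+-comm j i) ⟩
        g ^ (i + j) % p        ∎
        where open ≡-Reasoning

    -- The orbit of 0 is constant, so it cannot pass from outside the class of b into it. Hence 0
    -- may join the nonzero residues, and the sum ranges over the whole interval [0, p) that the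
    -- cells partition.
    F[0]≡0 : F 0 ≡ 0
    F[0]≡0 = χ-false (good? (N * 0 / p) 0) λ good →
      let (X₀≉b , X≈b) , _ = Equivalence.from (maximalRun⇔ 0 z<s s) good
      in X₀≉b (subst (λ a → a % p ≡ b [mod v ]) (trans (*-zeroʳ (g ^ 1)) (sym (*-zeroʳ (g ^ 0)))) (X≈b z<s))

    -- The sum over indices becomes a sum over starting points and is then cut into cells. On a cell
    -- the quotient c is constant, so the condition on its digits comes out as a factor.
    ρ≡∑ : ρ p g v b (suc s) ≡ ∑[ c < N ] ((∑[ y < width c ] χ (first? s c (e c + y))) * χ (word? s c))
    ρ≡∑ = begin
      ρ p g v b (suc s)
        ≡⟨ length-filter-applyUpTo (runAfter? p g v b (suc s)) suc m ⟩
      ∑[ i < m ] χ (runAfter? p g v b (suc s) (suc i))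
        ≡⟨ ∑-cong m (λ {i} _ → χ-cong (runAfter? p g v b (suc s) (suc i))
             (good? (N * pow (suc i) / p) (pow (suc i))) (runAfter⇔ (suc i))) ⟩
      ∑[ i < m ] F (pow (suc i))
        ≡⟨ ∑-orbit F ⟩
      ∑[ x < m ] F (suc x)
        ≡⟨ cong (_+ ∑[ x < m ] F (suc x)) F[0]≡0 ⟨
      ∑[ x < p ] F x
        ≡⟨ ∑-cells F ⟩
      ∑[ c < N ] ∑[ y < width c ] F (e c + y)
        ≡⟨ ∑-cong N (λ {c} _ → ∑-cong (width c) (λ {y} y<w →
             trans (cong (λ k → χ (good? k (e c + y))) (cell c y<w)) (χ-× (first? s c (e c + y)) (word? s c)))) ⟩
      ∑[ c < N ] ∑[ y < width c ] (χ (first? s c (e c + y)) * χ (word? s c))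
        ≡⟨ ∑-cong N (λ {c} _ → ∑-*ʳ (width c) (χ (word? s c)) (λ y → χ (first? s c (e c + y)))) ⟩
      ∑[ c < N ] ((∑[ y < width c ] χ (first? s c (e c + y))) * χ (word? s c))
        ∎
      where open ≡-Reasoning

    private
      -- As `p` is invertible modulo `v`, the digits satisfying `Keeps` form a single class, the K
      -- of the overview.
      keeps-class = affine-class p⊥v b (g * b)

      module Kept = ResidueClass keeps? (proj₁ (proj₂ keeps-class)) (proj₂ (proj₂ keeps-class))

      first-class : ∀ c → ∃[ x₀ ] x₀ < v × (∀ x → First s c x ⇔ (x ≡ x₀ [mod v ]))
      first-class c = affine-class g⊥v 0 (p * top s (c / g) + b)

      module Start (c : ℕ) = ResidueClass (first? s c) (proj₁ (proj₂ (first-class c))) (proj₂ (proj₂ (first-class c)))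

    -- Every cell has at least `q` points, hence at least `k₃` that satisfy `First`; the admissible
    -- c number `κ ^ s * κ̄ ^ 2`. The floors are represented by any naturals that obey their
    -- defining inequalities.
    ρ-lower : ∀ k₁ k₂ k₃ → k₁ * v ≤ g → k₂ * v ≤ (v ∸ 1) * g → k₃ * v ≤ q →
      k₁ ^ s * k₂ ^ 2 * k₃ ≤ ρ p g v b (suc s)
    ρ-lower k₁ k₂ k₃ k₁v≤ k₂v≤ k₃v≤ = begin
      k₁ ^ s * k₂ ^ 2 * k₃
        ≤⟨ *-monoˡ-≤ k₃ (*-mono-≤ (^-monoˡ-≤ s (Kept.count-lower 0 k₁ k₁v≤))
                                                 (^-monoˡ-≤ 2 (Kept.complement-lower k₂ k₂v≤))) ⟩
      κ ^ s * κ̄ ^ 2 * k₃                      ≡⟨ cong (_* k₃) (∑-word s) ⟨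
      (∑[ c < N ] χ (word? s c)) * k₃         ≡⟨ *-comm _ k₃ ⟩
      k₃ * (∑[ c < N ] χ (word? s c))         ≡⟨ ∑-*ˡ N k₃ (χ ∘ word? s) ⟨
      ∑[ c < N ] (k₃ * χ (word? s c))
        ≤⟨ ∑-mono N (λ {c} _ → *-monoˡ-≤ (χ (word? s c)) (Start.count-lower c (e c) k₃ (≤-trans k₃v≤ (width-lower c)))) ⟩
      ∑[ c < N ] ((∑[ y < width c ] χ (first? s c (e c + y))) * χ (word? s c))  ≡⟨ ρ≡∑ ⟨
      ρ p g v b (suc s)                       ∎
      where open ≤-Reasoning

    ρ-upper : ∀ k₁ k₂ k₃ → g ≤ k₁ * v → (v ∸ 1) * g ≤ k₂ * v → q + 1 ≤ k₃ * v →
      ρ p g v b (suc s) ≤ k₁ ^ s * k₂ ^ 2 * k₃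
    ρ-upper k₁ k₂ k₃ ≤k₁v ≤k₂v ≤k₃v = begin
      ρ p g v b (suc s)                       ≡⟨ ρ≡∑ ⟩
      ∑[ c < N ] ((∑[ y < width c ] χ (first? s c (e c + y))) * χ (word? s c))
        ≤⟨ ∑-mono N (λ {c} _ → *-monoˡ-≤ (χ (word? s c)) (Start.count-upper c (e c) k₃ (≤-trans (width-upper c) ≤k₃v))) ⟩
      ∑[ c < N ] (k₃ * χ (word? s c))         ≡⟨ ∑-*ˡ N k₃ (χ ∘ word? s) ⟩
      k₃ * (∑[ c < N ] χ (word? s c))         ≡⟨ *-comm _ k₃ ⟨
      (∑[ c < N ] χ (word? s c)) * k₃         ≡⟨ cong (_* k₃) (∑-word s) ⟩
      κ ^ s * κ̄ ^ 2 * k₃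
        ≤⟨ *-monoˡ-≤ k₃ (*-mono-≤ (^-monoˡ-≤ s (Kept.count-upper 0 k₁ ≤k₁v))
                                                 (^-monoˡ-≤ 2 (Kept.complement-upper k₂ ≤k₂v))) ⟩
      k₁ ^ s * k₂ ^ 2 * k₃                    ∎
      where open ≤-Reasoning

-- Integer floors and ceilings

open import Data.Integer.Base as ℤ using (+_; _*_; _^_; _≤_)
open import Data.Rational.Unnormalised.Base using (_/_; floor; ceiling)

floor-spec : ∀ a v .{{_ : NonZero v}} → ∃[ k ] floor (+ a / v) ≡ + k × k ℕ.* v ℕ.≤ a
floor-spec a v@(suc _) = a ℕ./ v , ℤ.div-pos-is-/ℕ (+ a) v , ℕ.m/n*n≤m a v

ceiling-spec : ∀ a v .{{_ : NonZero v}} → ∃[ k ] ceiling (+ a / v) ≡ + k × a ℕ.≤ k ℕ.* v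
ceiling-spec zero    v@(suc _) = 0 , refl , ℕ.z≤n
ceiling-spec (suc a) v@(suc _) rewrite ℤ.div-pos-is-/ℕ (ℤ.-[1+ a ]) v {{_}} with suc a ℕ.% v in eq
-- The ceiling is minus the floor of -a / v, and division of a negative integer distinguishes
-- whether the remainder of its absolute value vanishes.
... | zero  = suc a ℕ./ v , ℤ.neg-involutive _ ,
  ℕ.≤-reflexive (trans (ℕ.m≡m%n+[m/n]*n (suc a) v) (cong (ℕ._+ suc a ℕ./ v ℕ.* v) eq))
... | suc r = suc (suc a ℕ./ v) , refl , (begin
  suc a                                  ≡⟨ ℕ.m≡m%n+[m/n]*n (suc a) v ⟩
  suc a ℕ.% v ℕ.+ suc a ℕ./ v ℕ.* v      ≤⟨ ℕ.+-monoˡ-≤ _ (ℕ.m%n≤n (suc a) v) ⟩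
  v ℕ.+ suc a ℕ./ v ℕ.* v                ∎)
  where open ℕ.≤-Reasoning

pos-^ : ∀ k n → + (k ℕ.^ n) ≡ (+ k) ^ n
pos-^ k zero    = refl
pos-^ k (suc n) = trans (ℤ.pos-* k (k ℕ.^ n)) (cong (+ k *_) (pos-^ k n))

pos-product : ∀ {i j l} k₁ k₂ k₃ s → i ≡ + k₁ → j ≡ + k₂ → l ≡ + k₃ →
  i ^ s * j ^ 2 * l ≡ + (k₁ ℕ.^ s ℕ.* k₂ ℕ.^ 2 ℕ.* k₃)
pos-product k₁ k₂ k₃ s refl refl refl = begin
  (+ k₁) ^ s * (+ k₂) ^ 2 * + k₃           ≡⟨ cong₂ (λ a b → a * b * + k₃) (pos-^ k₁ s) (pos-^ k₂ 2) ⟨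
  + (k₁ ℕ.^ s) * + (k₂ ℕ.^ 2) * + k₃       ≡⟨ cong (_* + k₃) (ℤ.pos-* (k₁ ℕ.^ s) (k₂ ℕ.^ 2)) ⟨
  + (k₁ ℕ.^ s ℕ.* k₂ ℕ.^ 2) * + k₃         ≡⟨ ℤ.pos-* (k₁ ℕ.^ s ℕ.* k₂ ℕ.^ 2) k₃ ⟨
  + (k₁ ℕ.^ s ℕ.* k₂ ℕ.^ 2 ℕ.* k₃)         ∎
  where open ≡-Reasoning

theorem10 : ∀ (p v g t b q r : ℕ) .{{_ : NonZero p}} .{{_ : NonZero v}} →
    Prime p → ¬ (2 ∣ p) →
    1 ℕ.< v → v ℕ.< p ∸ 1 →
    2 ℕ.≤ g → g ℕ.≤ p ∸ 1 → PrimitiveRoot p g →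
    gcd g v ≡ 1 →
    1 ℕ.≤ t →
    b ℕ.< v →
    p ≡ q ℕ.* g ℕ.^ (t ℕ.+ 1) ℕ.+ r → r ℕ.< g ℕ.^ (t ℕ.+ 1) →
    ( floor (+ g / v) ^ (t ∸ 1)
    * floor (+ ((v ∸ 1) ℕ.* g) / v) ^ 2
    * floor (+ q / v)
    ≤ + ρ p g v b t )
    × ( + ρ p g v b t
    ≤ ceiling (+ g / v) ^ (t ∸ 1)
    * ceiling (+ ((v ∸ 1) ℕ.* g) / v) ^ 2
    * ceiling (+ (q ℕ.+ 1) / v) )
theorem10 p@(suc m) v g t@(suc s) b q r p-prime _ _ v<m 2≤g _ g-root gcd≡1 _ _ p≡ r<
  with k₁ , eq₁ , k₁v≤ ← floor-spec g v
     | k₂ , eq₂ , k₂v≤ ← floor-spec ((v ∸ 1) ℕ.* g) v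
     | k₃ , eq₃ , k₃v≤ ← floor-spec q v
     | l₁ , eq₄ , ≤l₁v ← ceiling-spec g v
     | l₂ , eq₅ , ≤l₂v ← ceiling-spec ((v ∸ 1) ℕ.* g) v
     | l₃ , eq₆ , ≤l₃v ← ceiling-spec (q ℕ.+ 1) v
  = ℤ.≤-trans (ℤ.≤-reflexive (pos-product k₁ k₂ k₃ s eq₁ eq₂ eq₃)) (ℤ.+≤+ (ρ-lower k₁ k₂ k₃ k₁v≤ k₂v≤ k₃v≤))
  , ℤ.≤-trans (ℤ.+≤+ (ρ-upper l₁ l₂ l₃ ≤l₁v ≤l₂v ≤l₃v)) (ℤ.≤-reflexive (sym (pos-product l₁ l₂ l₃ s eq₄ eq₅ eq₆)))
  where
  t+1≡ : t ℕ.+ 1 ≡ suc t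
  t+1≡ = ℕ.+-comm t 1
  -- Coprimality of `p` and `v` comes from 0 < v < p and the primality of `p`.
  open Count b s q {{ℕ.>-nonZero (ℕ.<-trans (ℕ.s≤s ℕ.z≤n) 2≤g)}} p-prime g-root
    (gcd≡1⇒coprime gcd≡1) (prime⇒coprime p-prime (ℕ.m<n⇒m<1+n v<m))
    (subst (λ n → p ≡ q ℕ.* g ℕ.^ n ℕ.+ r) t+1≡ p≡)
    (ℕ.<⇒≤ (subst (λ n → r ℕ.< g ℕ.^ n) t+1≡ r<))
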